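{- Let $!_{a}$ be an abstract factorial. Then there is a sequence of positive integers $(h_n)_{n\ge 0}$ with $h_0=1$ and $n!_{a}=n!\,h_n$ for all $n\in\mathbb{N}$, such that for each $n\in\mathbb{N}$, $$h_k\,h_{n-k}\ \Big|\ h_n\binom{n}{k},\qquad k=0,1,2,\dots,n. \qquad (*)$$ Conversely, if $(h_n)_{n\ge 0}$ is a sequence of positive integers satisfying $h_0=1$ and $(*)$ for each $n\in\mathbb{N}$, then the function $!_{a}:\mathbb{N}\to\mathbb{Z}^+$ defined by $n!_{a}=n!\,h_n$ is an abstract factorial.
   Context: $\mathbb{N}=\{0,1,2,\dots\}$ and $\mathbb{Z}^+=\{1,2,3,\dots\}$; $n!$ and $\binom{n}{k}$ denote the ordinary factorial and binomial coefficient. An abstract factorial is a function $!_{a}:\mathbb{N}\to\mathbb{Z}^+$, $n\mapsto n!_{a}$, such that: (1) $0!_{a}=1$; (2) for all integers $0\le k\le n$, the generalized binomial coefficient $\binom{n}{k}_{a}:=\frac{n!_{a}}{k!_{a}\,(n-k)!_{a}}$ is a positive integer; (3) for every positive integer $n$, $n!$ divides $n!_{a}$. -}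

module Defs where

open import Data.Integer.Base using (+_)
open import Data.Nat.Base using (ℕ; _*_; _∸_; _≤_; _!; NonZero)
open import Data.Nat.Combinatorics using (_C_)
open import Data.Nat.Divisibility using (_∣_)
open import Data.Nat.Properties using (m*n≢0)
open import Data.Product.Base using (∃-syntax; _×_)
open import Data.Rational.Base using (ℚ; _/_)
open import Relation.Binary.PropositionalEquality.Core using (_≡_)

-- A map ℕ → ℤ⁺ is represented by a map ℕ → ℕ all of whose values are
-- nonzero.
AllPositive : (ℕ → ℕ) → Set
AllPositive f = ∀ n → NonZero (f n)

IsPositiveInteger : ℚ → Set
IsPositiveInteger q = ∃[ m ] NonZero m × q ≡ + m / 1

-- Meaningful only for k ≤ n, because _∸_ truncates.
generalizedBinomial : (f : ℕ → ℕ) → AllPositive f → ℕ → ℕ → ℚ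
generalizedBinomial f f≢0 n k =
  _/_ (+ f n) (f k * f (n ∸ k))
    {{m*n≢0 (f k) (f (n ∸ k)) {{f≢0 k}} {{f≢0 (n ∸ k)}}}}

record IsAbstractFactorial (f : ℕ → ℕ) : Set where
  field
    positive          : AllPositive f
    f0≡1              : f 0 ≡ 1
    binomial-integral : ∀ n k → k ≤ n →
                        IsPositiveInteger (generalizedBinomial f positive n k)
    n!∣fn             : ∀ n → NonZero n → n ! ∣ f n

BinomialDivisibility : (ℕ → ℕ) → ℕ → Set
BinomialDivisibility h n =
  ∀ k → k ≤ n → h k * h (n ∸ k) ∣ h n * (n C k)

{-# OPTIONS --safe #-}

-- Since k! (n ∸ k)! · (n C k) = n!, multiplying the divisibility
-- h k · h (n ∸ k) ∣ h n · (n C k) through by k! (n ∸ k)! turns it into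
-- f k · f (n ∸ k) ∣ f n, where f n = n! · h n; and this says that the
-- generalized binomial coefficient of f is an integer.
module Submission where

open import Defs
open import Data.Integer.Base using (+_)
open import Data.Integer.Properties using (+-injective; pos-*)
open import Data.Nat.Base using (ℕ; zero; suc; _*_; _∸_; _≤_; _!; NonZero)
open import Data.Nat.Combinatorics using (_C_; nCk≡n!/k![n-k]!; [n∸k]!k!∣n!)
open import Data.Nat.Divisibility
  using (_∣_; divides; quotient; quotient≢0; m∣n⇒n≡m*quotient; m∣m*n; 1∣_;
         *-monoʳ-∣; *-cancelˡ-∣)
open import Data.Nat.DivMod using (m*[n/m]≡n)
open import Data.Nat.Properties
  using (_!≢0; _!*_!≢0; m*n≢0; *-comm; *-identityˡ; *-identityʳ;
         *-commutativeSemigroup)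
open import Data.Product.Base using (∃-syntax; _×_; _,_)
open import Data.Rational.Base using (_/_)
open import Data.Rational.Properties using (fromℚᵘ-cong; fromℚᵘ-injective)
open import Data.Rational.Unnormalised.Base using (mkℚᵘ; *≡*)
open import Relation.Binary.PropositionalEquality
  using (_≡_; refl; sym; trans; cong; cong₂; subst; subst₂; module ≡-Reasoning)

open import Algebra.Properties.CommutativeSemigroup *-commutativeSemigroup
  using (interchange; x∙yz≈y∙xz)

-- `_/_` reduces to lowest terms, so numerators cannot be compared directly. Both sides are images
-- under `fromℚᵘ` of unnormalised fractions, and its injectivity gives the cross-multiplied equation
-- between `a * 1` and `m * d` in the integers.
isPositiveInteger⇒∣ : ∀ a d .{{_ : NonZero d}} →
                      IsPositiveInteger (+ a / d) → d ∣ a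
isPositiveInteger⇒∣ a d@(suc d-1) (m , _ , a/d≡m)
  -- `mkℚᵘ` stores the denominator minus one: `d-1` and `0` encode `d` and 1.
  with *≡* eq ← fromℚᵘ-injective {mkℚᵘ (+ a) d-1} {mkℚᵘ (+ m) 0} a/d≡m
  = divides m (+-injective (begin
      + a        ≡⟨ cong +_ (*-identityʳ a) ⟨
      + (a * 1)  ≡⟨ pos-* a 1 ⟩
      _          ≡⟨ eq ⟩
      _          ≡⟨ pos-* m d ⟨
      + (m * d)  ∎))
  where open ≡-Reasoning

∣⇒isPositiveInteger : ∀ a d .{{_ : NonZero a}} .{{_ : NonZero d}} →
                      d ∣ a → IsPositiveInteger (+ a / d)
∣⇒isPositiveInteger a d@(suc d-1) d∣a@(divides m a≡m*d) =
  -- The quotient is nonzero because `a` is.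
  m , quotient≢0 d∣a ,
  fromℚᵘ-cong {mkℚᵘ (+ a) d-1} {mkℚᵘ (+ m) 0} (*≡* (begin
    _          ≡⟨ pos-* a 1 ⟨
    + (a * 1)  ≡⟨ cong +_ (trans (*-identityʳ a) a≡m*d) ⟩
    + (m * d)  ≡⟨ pos-* m d ⟩
    _          ∎))
  where open ≡-Reasoning

-- The library's factorial formula for `_C_` uses truncated division, which is exact here because
-- the denominator divides `n !`.
k![n∸k]!*nCk≡n! : ∀ {n k} → k ≤ n → k ! * (n ∸ k) ! * (n C k) ≡ n !
k![n∸k]!*nCk≡n! {n} {k} k≤n = trans
  (cong (k ! * (n ∸ k) ! *_) (nCk≡n!/k![n-k]! k≤n))
  (m*[n/m]≡n
    (subst (_∣ n !) (*-comm ((n ∸ k) !) (k !)) ([n∸k]!k!∣n! k≤n)))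
  where instance _ = k !* (n ∸ k) !≢0

-- A propositional link between `f` and `h` serves both directions of the theorem: either `h` is
-- extracted from `f` by division, or `f` is defined as the product.
module _ (f h : ℕ → ℕ) (f≡!*h : ∀ n → f n ≡ n ! * h n)
         {n k : ℕ} (k≤n : k ≤ n) where

  private
    D : ℕ
    D = k ! * (n ∸ k) !

    D*hh≡ff : D * (h k * h (n ∸ k)) ≡ f k * f (n ∸ k)
    D*hh≡ff = trans
      (interchange (k !) ((n ∸ k) !) (h k) (h (n ∸ k)))
      (sym (cong₂ _*_ (f≡!*h k) (f≡!*h (n ∸ k))))

    D*hC≡f : D * (h n * (n C k)) ≡ f n
    D*hC≡f = begin
      D * (h n * (n C k))  ≡⟨ x∙yz≈y∙xz D (h n) (n C k) ⟩
      h n * (D * (n C k))  ≡⟨ cong (h n *_) (k![n∸k]!*nCk≡n! k≤n) ⟩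
      h n * n !            ≡⟨ *-comm (h n) (n !) ⟩
      n ! * h n            ≡⟨ f≡!*h n ⟨
      f n                  ∎
      where open ≡-Reasoning

  hh∣hC⇒ff∣f : h k * h (n ∸ k) ∣ h n * (n C k) → f k * f (n ∸ k) ∣ f n
  hh∣hC⇒ff∣f hh∣hC = subst₂ _∣_ D*hh≡ff D*hC≡f (*-monoʳ-∣ D hh∣hC)

  -- The scaling by `D` can be undone because a product of factorials is nonzero.
  ff∣f⇒hh∣hC : f k * f (n ∸ k) ∣ f n → h k * h (n ∸ k) ∣ h n * (n C k)
  ff∣f⇒hh∣hC ff∣f =
    *-cancelˡ-∣ D {{k !* (n ∸ k) !≢0}} (subst₂ _∣_ (sym D*hh≡ff) (sym D*hC≡f) ff∣f)

module _ {f : ℕ → ℕ} (isAbstractFactorial : IsAbstractFactorial f) where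
  open IsAbstractFactorial isAbstractFactorial

  n!∣f : ∀ n → n ! ∣ f n
  -- `n!∣fn` covers only positive `n`; here `0 !` computes to 1.
  n!∣f zero      = 1∣ f 0
  n!∣f n@(suc _) = n!∣fn n _

  cofactor : ℕ → ℕ
  cofactor n = quotient (n!∣f n)

  f≡n!*cofactor : ∀ n → f n ≡ n ! * cofactor n
  f≡n!*cofactor n = m∣n⇒n≡m*quotient (n!∣f n)

  cofactor-positive : AllPositive cofactor
  cofactor-positive n = quotient≢0 (n!∣f n) {{positive n}}

  cofactor0≡1 : cofactor 0 ≡ 1
  cofactor0≡1 =
    trans (sym (*-identityˡ (cofactor 0))) (trans (sym (f≡n!*cofactor 0)) f0≡1)

  cofactor-binomialDivisibility : ∀ n → BinomialDivisibility cofactor n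
  cofactor-binomialDivisibility n k k≤n =
    ff∣f⇒hh∣hC f cofactor f≡n!*cofactor k≤n
      (isPositiveInteger⇒∣ (f n) (f k * f (n ∸ k)) (binomial-integral n k k≤n))
    -- `_/_` takes its nonzeroness proof irrelevantly, so this instance agrees with the one inside
    -- `generalizedBinomial`.
    where instance _ = m*n≢0 _ _ {{positive k}} {{positive (n ∸ k)}}

n!*h-isAbstractFactorial : ∀ (h : ℕ → ℕ) → AllPositive h → h 0 ≡ 1 →
                           (∀ n → BinomialDivisibility h n) →
                           IsAbstractFactorial (λ n → n ! * h n)
n!*h-isAbstractFactorial h h≢0 h0≡1 hh∣hC = record
  { positive          = f≢0
  ; f0≡1              = trans (*-identityˡ (h 0)) h0≡1
  ; binomial-integral = λ n k k≤n →
      ∣⇒isPositiveInteger (f n) (f k * f (n ∸ k))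
        {{f≢0 n}} {{m*n≢0 _ _ {{f≢0 k}} {{f≢0 (n ∸ k)}}}}
        (hh∣hC⇒ff∣f f h (λ _ → refl) k≤n (hh∣hC n k k≤n))
  ; n!∣fn             = λ n _ → m∣m*n (h n)
  }
  where
  f : ℕ → ℕ
  f n = n ! * h n

  f≢0 : AllPositive f
  f≢0 n = m*n≢0 (n !) (h n) {{n !≢0}} {{h≢0 n}}

proposition4 : (∀ (f : ℕ → ℕ) → IsAbstractFactorial f →
    ∃[ h ] AllPositive h
    × h 0 ≡ 1
    × (∀ n → f n ≡ n ! * h n)
    × (∀ n → BinomialDivisibility h n))
    ×
    (∀ (h : ℕ → ℕ) → AllPositive h → h 0 ≡ 1 →
    (∀ n → BinomialDivisibility h n) →
    IsAbstractFactorial (λ n → n ! * h n))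
proposition4 =
  (λ _ !ₐ → cofactor !ₐ , cofactor-positive !ₐ , cofactor0≡1 !ₐ ,
            f≡n!*cofactor !ₐ , cofactor-binomialDivisibility !ₐ) ,
  n!*h-isAbstractFactorial
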